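{- Let $G_1$ be an FC-group (every element has a centraliser of finite index), let $n,m\ge 0$, let $G\le G_1^n$ be a subgroup, let $w(\bar x,\bar y)$ be a group word in the variables $\bar x=(x_1,\dots,x_n)$, $\bar y=(y_1,\dots,y_m)$ and their inverses, and let $\bar g\in G_1^m$ and $c\in G_1$. If the set $X=\{\bar h\in G: w(\bar h,\bar g)=c\}$ is large in $G$, then $w(\bar h,\bar g)=c$ for all $\bar h\in G$.
   Context: $w(\bar x,\bar g)$ induces a function $G\to G_1$ by substitution. A subset $X\subseteq G$ is $k$-large in $G$ if the intersection of any $k$ left translates $\bar a_1X\cap\dots\cap\bar a_kX$ ($\bar a_i\in G$) is non-empty; $X$ is large in $G$ if it is $k$-large for every $k\ge1$. -}

module Defs where

open import Algebra.Bundles using (Group)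
open import Algebra.Construct.Pointwise using () renaming (group to powerGroup)
open import Data.Fin.Base using (Fin)
open import Data.List.Base using (List; map; foldr)
open import Data.List.Relation.Unary.Enumerates.Setoid using (IsEnumeration)
open import Data.Nat.Base using (ℕ; _≥_)
open import Data.Product.Base using (Σ; ∃; _×_; _,_; proj₁)
open import Data.Sign.Base as Sign using (Sign)
open import Data.Sum.Base using (_⊎_; [_,_]′)
open import Level using (Level; _⊔_) renaming (suc to lsuc)
open import Relation.Binary.Bundles using (Setoid)
open import Relation.Binary.Definitions using (_Respects_)
open import Relation.Unary using (Pred; _∈_; ⋂; Satisfiable)
import Algebra.Properties.Group as GroupProperties
import Relation.Binary.Reasoning.Setoid as SetoidReasoning

infixr 8 _^ᴳ_

_^ᴳ_ : {c ℓ : Level} → Group c ℓ → ℕ → Group c ℓ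
G ^ᴳ n = powerGroup (Fin n) G

record Subgroup {c ℓ : Level} (G : Group c ℓ) (p : Level) : Set (c ⊔ ℓ ⊔ lsuc p) where
  open Group G
  field
    Member    : Pred Carrier p
    resp      : Member Respects _≈_
    ε-closed  : ε ∈ Member
    ∙-closed  : {x y : Carrier} → x ∈ Member → y ∈ Member → (x ∙ y) ∈ Member
    ⁻¹-closed : {x : Carrier} → x ∈ Member → (x ⁻¹) ∈ Member

  asGroup : Group (c ⊔ p) ℓ
  asGroup = record
    { Carrier = Σ Carrier Member
    ; _≈_     = λ x y → proj₁ x ≈ proj₁ y
    ; _∙_     = λ { (x , x∈) (y , y∈) → x ∙ y , ∙-closed x∈ y∈ }
    ; ε       = ε , ε-closed
    ; _⁻¹     = λ { (x , x∈) → x ⁻¹ , ⁻¹-closed x∈ }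
    ; isGroup = record
      { isMonoid = record
        { isSemigroup = record
          { isMagma = record
            { isEquivalence = record { refl = refl ; sym = sym ; trans = trans }
            ; ∙-cong        = ∙-cong
            }
          ; assoc = λ x y z → assoc (proj₁ x) (proj₁ y) (proj₁ z)
          }
        ; identity = (λ x → identityˡ (proj₁ x)) , (λ x → identityʳ (proj₁ x))
        }
      ; inverse = (λ x → inverseˡ (proj₁ x)) , (λ x → inverseʳ (proj₁ x))
      ; ⁻¹-cong = ⁻¹-cong
      }
    }

module _ {c ℓ : Level} (G : Group c ℓ) where
  open Group G
  open GroupProperties G
  open SetoidReasoning setoid

  -- The set G/H of left cosets xH, as a setoid: xH = yH iff x⁻¹y ∈ H.
  leftCosets : {p : Level} → Subgroup G p → Setoid c p
  leftCosets H = record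
    { Carrier       = Carrier
    ; _≈_           = λ x y → (x ⁻¹ ∙ y) ∈ Member
    ; isEquivalence = record
      { refl  = λ {x} → resp (sym (inverseˡ x)) ε-closed
      ; sym   = λ {x} {y} x~y → resp (sym-eq x y) (⁻¹-closed x~y)
      ; trans = λ {x} {y} {z} x~y y~z → resp (trans-eq x y z) (∙-closed x~y y~z)
      }
    }
    where
    open Subgroup H

    sym-eq : ∀ x y → (x ⁻¹ ∙ y) ⁻¹ ≈ y ⁻¹ ∙ x
    sym-eq x y = begin
      (x ⁻¹ ∙ y) ⁻¹    ≈⟨ ⁻¹-anti-homo-∙ (x ⁻¹) y ⟩
      y ⁻¹ ∙ x ⁻¹ ⁻¹   ≈⟨ ∙-congˡ (⁻¹-involutive x) ⟩
      y ⁻¹ ∙ x         ∎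

    trans-eq : ∀ x y z → (x ⁻¹ ∙ y) ∙ (y ⁻¹ ∙ z) ≈ x ⁻¹ ∙ z
    trans-eq x y z = begin
      (x ⁻¹ ∙ y) ∙ (y ⁻¹ ∙ z)   ≈⟨ assoc (x ⁻¹) y (y ⁻¹ ∙ z) ⟩
      x ⁻¹ ∙ (y ∙ (y ⁻¹ ∙ z))   ≈⟨ ∙-congˡ (assoc y (y ⁻¹) z) ⟨
      x ⁻¹ ∙ ((y ∙ y ⁻¹) ∙ z)   ≈⟨ ∙-congˡ (∙-congʳ (inverseʳ y)) ⟩
      x ⁻¹ ∙ (ε ∙ z)            ≈⟨ ∙-congˡ (identityˡ z) ⟩
      x ⁻¹ ∙ z                  ∎

  -- The enumeration may repeat cosets, so membership in H need not be decidable.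
  FiniteIndex : {p : Level} → Subgroup G p → Set (c ⊔ p)
  FiniteIndex H = ∃ λ reps → IsEnumeration (leftCosets H) reps

  centraliser : Carrier → Subgroup G ℓ
  centraliser g = record
    { Member    = λ x → x ∙ g ≈ g ∙ x
    ; resp      = λ x≈y xg≈gx → trans (∙-congʳ (sym x≈y)) (trans xg≈gx (∙-congˡ x≈y))
    ; ε-closed  = trans (identityˡ g) (sym (identityʳ g))
    ; ∙-closed  = λ {x} {y} xg≈gx yg≈gy → begin
        (x ∙ y) ∙ g   ≈⟨ assoc x y g ⟩
        x ∙ (y ∙ g)   ≈⟨ ∙-congˡ yg≈gy ⟩
        x ∙ (g ∙ y)   ≈⟨ assoc x g y ⟨
        (x ∙ g) ∙ y   ≈⟨ ∙-congʳ xg≈gx ⟩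
        (g ∙ x) ∙ y   ≈⟨ assoc g x y ⟩
        g ∙ (x ∙ y)   ∎
    ; ⁻¹-closed = λ {x} xg≈gx → ∙-cancelˡ x _ _ (begin
        x ∙ (x ⁻¹ ∙ g)   ≈⟨ assoc x (x ⁻¹) g ⟨
        (x ∙ x ⁻¹) ∙ g   ≈⟨ ∙-congʳ (inverseʳ x) ⟩
        ε ∙ g            ≈⟨ identityˡ g ⟩
        g                ≈⟨ identityʳ g ⟨
        g ∙ ε            ≈⟨ ∙-congˡ (inverseʳ x) ⟨
        g ∙ (x ∙ x ⁻¹)   ≈⟨ assoc g x (x ⁻¹) ⟨
        (g ∙ x) ∙ x ⁻¹   ≈⟨ ∙-congʳ xg≈gx ⟨
        (x ∙ g) ∙ x ⁻¹   ≈⟨ assoc x g (x ⁻¹) ⟩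
        x ∙ (g ∙ x ⁻¹)   ∎)
    }

  IsFC : Set (c ⊔ ℓ)
  IsFC = ∀ g → FiniteIndex (centraliser g)

  leftTranslate : {p : Level} → Carrier → Pred Carrier p → Pred Carrier (c ⊔ ℓ ⊔ p)
  leftTranslate a X y = ∃ λ x → x ∈ X × y ≈ a ∙ x

  IsKLarge : {p : Level} → ℕ → Pred Carrier p → Set (c ⊔ ℓ ⊔ p)
  IsKLarge k X = (a : Fin k → Carrier) → Satisfiable (⋂ (Fin k) (λ i → leftTranslate (a i) X))

  IsLarge : {p : Level} → Pred Carrier p → Set (c ⊔ ℓ ⊔ p)
  IsLarge X = ∀ k → k ≥ 1 → IsKLarge k X

-- Words need not be freely reduced.
Word : {v : Level} → Set v → Set v
Word V = List (Sign × V)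

module _ {c ℓ : Level} (G : Group c ℓ) where
  open Group G

  evalLetter : {v : Level} {V : Set v} → (V → Carrier) → Sign × V → Carrier
  evalLetter ρ (Sign.+ , v) = ρ v
  evalLetter ρ (Sign.- , v) = ρ v ⁻¹

  evalWord : {v : Level} {V : Set v} → Word V → (V → Carrier) → Carrier
  evalWord w ρ = foldr _∙_ ε (map (evalLetter ρ) w)

  -- w(h̄, ḡ), where inj₁ i stands for the variable xᵢ and inj₂ j for yⱼ.
  substitute : {n m : ℕ} → Word (Fin n ⊎ Fin m) → (Fin n → Carrier) → (Fin m → Carrier) → Carrier
  substitute w h g = evalWord w [ h , g ]′

{-# OPTIONS --safe #-}
-- For h ∈ G let K ≤ G₁ⁿ consist of the tuples all of whose entries commute with every hᵢ and
-- every gⱼ; since G₁ is FC, K has finite index.  For x ∈ K the word splits as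
-- w(hx,g) = w(h,g) w(x,1) and w(x,g) = w(1,g) w(x,1), so as soon as x and hx both lie in X we get
-- w(h,g) = w(1,g).  Such an x is found by building z₁, z₂, … in G with
-- zⱼ ∈ zᵢX ∩ zᵢh⁻¹X for all i < j: two of them lie in the same coset of K, and x = zᵢ⁻¹zⱼ works.
-- (Working with the zᵢ avoids choosing representatives of the cosets of K in G, which cannot be
-- done constructively because membership in G is not decidable.)
module Submission where

open import Defs
open import Algebra.Bundles using (Group)
open import Data.Fin.Base using (Fin; zero; suc; _<_; _↑ˡ_; _↑ʳ_; combine)
open import Data.Fin.Properties using (pigeonhole; combine-injective)
open import Data.List.Base using ([]; _∷_; length; lookup)
open import Data.List.Relation.Unary.Any using (index)
open import Data.List.Relation.Unary.Any.Properties using (lookup-index)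
open import Data.Nat.Base using (ℕ; zero; suc; _+_; _*_; z<s; s<s)
open import Data.Nat.Properties using (n<1+n)
open import Data.Product.Base using (∃₂; Σ-syntax; ∃-syntax; _×_; _,_; proj₁)
open import Data.Sign.Base as Sign using ()
open import Data.Sum.Base using (_⊎_; inj₁; inj₂; [_,_]′)
open import Data.Vec.Functional as Vector using (_++_)
open import Data.Vec.Functional.Properties using (lookup-++ˡ; lookup-++ʳ)
open import Function.Base using (_∘_)
open import Level using (Level; _⊔_)
open import Relation.Binary.Bundles using (Setoid)
open import Relation.Binary.Core using (Rel)
open import Relation.Binary.PropositionalEquality.Core as ≡ using (_≡_; subst)
open import Relation.Unary using (Pred; _∈_; Satisfiable)
import Algebra.Properties.Group as GroupProperties
import Relation.Binary.Reasoning.Setoid as SetoidReasoning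

private variable
  a ℓ p q r : Level

-- The form in which finite index is used: the cosets of a finite-index subgroup are finitely
-- many colours, but no colour is required to be attained.
FinitelyColourable : {A : Set a} → Rel A r → Set (a ⊔ r)
FinitelyColourable {A = A} R =
  ∃[ k ] Σ[ χ ∈ (A → Fin k) ] (∀ x y → χ x ≡ χ y → R x y)

colourable-∘ : {A : Set a} {B : Set q} {R : Rel B r} (f : A → B) →
  FinitelyColourable R → FinitelyColourable (λ x y → R (f x) (f y))
colourable-∘ f (k , χ , χ⇒R) = k , χ ∘ f , λ x y → χ⇒R (f x) (f y)

colourable-⋂ : {A : Set a} {m : ℕ} {R : Fin m → Rel A r} →
  (∀ i → FinitelyColourable (R i)) → FinitelyColourable (λ x y → ∀ i → R i x y)
colourable-⋂ {m = zero}  _ = 1 , (λ _ → zero) , λ _ _ _ ()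
colourable-⋂ {m = suc m} {R} cR with cR zero | colourable-⋂ {R = R ∘ suc} (cR ∘ suc)
... | k , χ , χ⇒R | l , ψ , ψ⇒R =
  k * l , (λ x → combine (χ x) (ψ x)) , λ x y eq →
    let χ≡ , ψ≡ = combine-injective (χ x) (ψ x) (χ y) (ψ y) eq
    in λ { zero → χ⇒R x y χ≡ ; (suc i) → ψ⇒R x y ψ≡ i }

-- Colour by the position of a representative in the list: equal colours give a common
-- representative. As the list may repeat cosets, one coset may carry several colours.
finiteIndex⇒colourable : (G : Group a ℓ) (H : Subgroup G p) → FiniteIndex G H →
  FinitelyColourable (Setoid._≈_ (leftCosets G H))
finiteIndex⇒colourable G H (reps , enum) =
  length reps , index ∘ enum , λ x y eq →
    ~-trans {x} (subst (λ i → x ~ lookup reps i) eq (lookup-index (enum x)))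
      (~-sym {y} (lookup-index (enum y)))
  where open Setoid (leftCosets G H) using () renaming (_≈_ to _~_; trans to ~-trans; sym to ~-sym)

-- The chain grows at the front, hence runs against the order of the indices.
chain : {A : Set a} {R : Rel A r} →
  (∀ {k} (z : Fin k → A) → ∃[ y ] ∀ i → R (z i) y) →
  ∀ k → Σ[ z ∈ (Fin k → A) ] (∀ {i j} → i < j → R (z j) (z i))
chain ext zero = (λ ()) , λ { {()} }
chain {A = A} {R = R} ext (suc k) with chain {R = R} ext k
... | z , zR with ext z
...   | y , yR = y Vector.∷ z , ordered
  where
  ordered : ∀ {i j} → i < j → R ((y Vector.∷ z) j) ((y Vector.∷ z) i)
  ordered {zero}  {suc j} _         = yR j
  ordered {suc i} {suc j} (s<s i<j) = zR i<j

-- A chain with one more member than there are colours repeats a colour.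
chain-monochromatic : {A : Set a} {R : Rel A r} {S : Rel A q} →
  (∀ {k} (z : Fin k → A) → ∃[ y ] ∀ i → R (z i) y) →
  FinitelyColourable S → ∃₂ λ x y → R x y × S x y
chain-monochromatic {R = R} ext (k , χ , χ⇒S) with chain {R = R} ext (suc k)
... | z , zR with pigeonhole (n<1+n k) (χ ∘ z)
...   | i , j , i<j , χ≡ = z j , z i , zR i<j , χ⇒S (z j) (z i) (≡.sym χ≡)

module _ (G : Group a ℓ) where
  open Group G
  open GroupProperties G
  open SetoidReasoning setoid

  -- Zero translates occur when the first member of a chain is sought; any element then serves.
  large⇒kLarge : {X : Pred Carrier p} → IsLarge G X → ∀ k → IsKLarge G k X
  large⇒kLarge large zero    _ = ε , λ ()
  large⇒kLarge large (suc k) = large (suc k) z<s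

  large⇒satisfiable : {X : Pred Carrier p} → IsLarge G X → Satisfiable X
  large⇒satisfiable large = let _ , y∈ = large 1 z<s (λ _ → ε)
                                x , x∈X , _ = y∈ zero
                            in x , x∈X

  -- The step that extends the chain `z`: all `k + k` translates are intersected at once.
  large⇒translates-meet : {X : Pred Carrier p} → IsLarge G X →
    ∀ h {k} (z : Fin k → Carrier) →
    ∃[ y ] ∀ i → y ∈ leftTranslate G (z i) X × y ∈ leftTranslate G (z i ∙ h ⁻¹) X
  large⇒translates-meet {X = X} large h {k} z =
    let z′     = λ i → z i ∙ h ⁻¹
        y , y∈ = large⇒kLarge large (k + k) (z ++ z′)
        y∈gX b = y ∈ leftTranslate G b X
    in y , λ i → subst y∈gX (lookup-++ˡ z z′ i) (y∈ (i ↑ˡ k))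
               , subst y∈gX (lookup-++ʳ z z′ i) (y∈ (k ↑ʳ i))

  translates⇒∙ : ∀ {h x x′ y z} → y ≈ z ∙ x → y ≈ (z ∙ h ⁻¹) ∙ x′ → x′ ≈ h ∙ x
  translates⇒∙ {h} {x} {x′} {y} {z} y≈zx y≈zh⁻¹x′ = begin
    x′                ≈⟨ \\-leftDividesˡ h x′ ⟨
    h ∙ (h ⁻¹ ∙ x′)   ≈⟨ ∙-congˡ (∙-cancelˡ z _ _
                           (trans (sym (assoc z (h ⁻¹) x′)) (trans (sym y≈zh⁻¹x′) y≈zx))) ⟩
    h ∙ x             ∎

  -- Two chain members of one colour determine `x` as `z ⁻¹ ∙ y`. The product `h ∙ x` is in `X` only
  -- up to `_≈_`, so the actual member `x′` is returned as well.
  large⇒monochromatic : {X : Pred Carrier p} {S : Rel Carrier r} →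
    IsLarge G X → FinitelyColourable S → ∀ h →
    ∃₂ λ x x′ → x ∈ X × x′ ∈ X × x′ ≈ h ∙ x × ∃₂ λ z y → S z y × y ≈ z ∙ x
  large⇒monochromatic {X = X} large cS h =
    let z , y , ((x , x∈X , y≈zx) , (x′ , x′∈X , y≈zh⁻¹x′)) , Szy =
          chain-monochromatic
            {R = λ z y → y ∈ leftTranslate G z X × y ∈ leftTranslate G (z ∙ h ⁻¹) X}
            (large⇒translates-meet large h) cS
    in x , x′ , x∈X , x′∈X , translates⇒∙ y≈zx y≈zh⁻¹x′ , z , y , Szy , y≈zx

  Commute : Rel Carrier ℓ
  Commute x y = x ∙ y ≈ y ∙ x

  commute-ε : ∀ {x} → Commute ε x
  commute-ε {x} = Subgroup.ε-closed (centraliser G x)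

  commute-interchange : ∀ {x y u v} → Commute y u → (x ∙ y) ∙ (u ∙ v) ≈ (x ∙ u) ∙ (y ∙ v)
  commute-interchange {x} {y} {u} {v} yu≈uy = begin
    (x ∙ y) ∙ (u ∙ v)   ≈⟨ assoc x y (u ∙ v) ⟩
    x ∙ (y ∙ (u ∙ v))   ≈⟨ ∙-congˡ (assoc y u v) ⟨
    x ∙ ((y ∙ u) ∙ v)   ≈⟨ ∙-congˡ (∙-congʳ yu≈uy) ⟩
    x ∙ ((u ∙ y) ∙ v)   ≈⟨ ∙-congˡ (assoc u y v) ⟩
    x ∙ (u ∙ (y ∙ v))   ≈⟨ assoc x u (y ∙ v) ⟨
    (x ∙ u) ∙ (y ∙ v)   ∎

  module _ {V : Set q} where

    evalLetter-cong : {ρ σ : V → Carrier} → (∀ v → ρ v ≈ σ v) →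
      ∀ l → evalLetter G ρ l ≈ evalLetter G σ l
    evalLetter-cong ρ≈σ (Sign.+ , v) = ρ≈σ v
    evalLetter-cong ρ≈σ (Sign.- , v) = ⁻¹-cong (ρ≈σ v)

    evalWord-cong : {ρ σ : V → Carrier} → (∀ v → ρ v ≈ σ v) →
      ∀ w → evalWord G w ρ ≈ evalWord G w σ
    evalWord-cong ρ≈σ []      = refl
    evalWord-cong ρ≈σ (l ∷ w) = ∙-cong (evalLetter-cong ρ≈σ l) (evalWord-cong ρ≈σ w)

    module _ (H : Subgroup G p) {ρ : V → Carrier} (ρ∈H : ∀ v → ρ v ∈ Subgroup.Member H) where
      open Subgroup H

      evalLetter-closed : ∀ l → evalLetter G ρ l ∈ Member
      evalLetter-closed (Sign.+ , v) = ρ∈H v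
      evalLetter-closed (Sign.- , v) = ⁻¹-closed (ρ∈H v)

      evalWord-closed : ∀ w → evalWord G w ρ ∈ Member
      evalWord-closed []      = ε-closed
      evalWord-closed (l ∷ w) = ∙-closed (evalLetter-closed l) (evalWord-closed w)

    module _ {ρ σ : V → Carrier} (σρ≈ρσ : ∀ u v → Commute (σ u) (ρ v)) where

      evalLetter-∙ : ∀ l →
        evalLetter G (λ v → ρ v ∙ σ v) l ≈ evalLetter G ρ l ∙ evalLetter G σ l
      evalLetter-∙ (Sign.+ , v) = refl
      -- Commuting the factors first makes up for the reversal by inversion.
      evalLetter-∙ (Sign.- , v) = begin
        (ρ v ∙ σ v) ⁻¹    ≈⟨ ⁻¹-cong (σρ≈ρσ v v) ⟨
        (σ v ∙ ρ v) ⁻¹    ≈⟨ ⁻¹-anti-homo-∙ (σ v) (ρ v) ⟩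
        ρ v ⁻¹ ∙ σ v ⁻¹   ∎

      evalWord-∙ : ∀ w → evalWord G w (λ v → ρ v ∙ σ v) ≈ evalWord G w ρ ∙ evalWord G w σ
      evalWord-∙ []      = sym (identityˡ ε)
      evalWord-∙ (l ∷ w) = begin
        evalLetter G (λ v → ρ v ∙ σ v) l ∙ evalWord G w (λ v → ρ v ∙ σ v)
          ≈⟨ ∙-cong (evalLetter-∙ l) (evalWord-∙ w) ⟩
        (evalLetter G ρ l ∙ evalLetter G σ l) ∙ (evalWord G w ρ ∙ evalWord G w σ)
          ≈⟨ commute-interchange (sym ρw∙σl≈σl∙ρw) ⟩
        (evalLetter G ρ l ∙ evalWord G w ρ) ∙ (evalLetter G σ l ∙ evalWord G w σ) ∎
        where
        ρw∙σl≈σl∙ρw : Commute (evalWord G w ρ) (evalLetter G σ l)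
        -- Each letter under `σ` centralises every `ρ v`; hence every `ρ v`, and with it the value
        -- of any word under `ρ`, centralises that letter.
        ρw∙σl≈σl∙ρw = evalWord-closed (centraliser G (evalLetter G σ l))
          (λ v → sym (evalLetter-closed (centraliser G (ρ v)) (λ u → σρ≈ρσ u v) l)) w

  module _ {n m : ℕ} (w : Word (Fin n ⊎ Fin m)) (g : Fin m → Carrier) where

    substitute-cong : {h h′ : Fin n → Carrier} → (∀ i → h i ≈ h′ i) →
      substitute G w h g ≈ substitute G w h′ g
    substitute-cong h≈h′ = evalWord-cong (λ { (inj₁ i) → h≈h′ i ; (inj₂ _) → refl }) w

    substitute-∙ : {h x : Fin n → Carrier} →
      (∀ i j → Commute (x i) (h j)) → (∀ i j → Commute (x i) (g j)) →
      substitute G w (λ i → h i ∙ x i) g ≈ substitute G w h g ∙ substitute G w x (λ _ → ε)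
    substitute-∙ {h} {x} xh≈hx xg≈gx = trans
      -- Reading `g j` as `g j ∙ ε` splits the parameters into a product too.
      (evalWord-cong (λ { (inj₁ _) → refl ; (inj₂ j) → sym (identityʳ (g j)) }) w)
      (evalWord-∙ {ρ = [ h , g ]′} {σ = [ x , (λ _ → ε) ]′} commute w)
      where
      commute : ∀ u v → Commute ([ x , (λ _ → ε) ]′ u) ([ h , g ]′ v)
      commute (inj₁ i) (inj₁ j) = xh≈hx i j
      commute (inj₁ i) (inj₂ j) = xg≈gx i j
      commute (inj₂ _) v        = commute-ε

    substitute-≈-ε : {h x : Fin n → Carrier} →
      (∀ i j → Commute (x i) (h j)) → (∀ i j → Commute (x i) (g j)) →
      substitute G w (λ i → h i ∙ x i) g ≈ substitute G w x g →
      substitute G w h g ≈ substitute G w (λ _ → ε) g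
    substitute-≈-ε {h} {x} xh≈hx xg≈gx eq = ∙-cancelʳ (substitute G w x (λ _ → ε)) _ _ (begin
      substitute G w h g ∙ substitute G w x (λ _ → ε)         ≈⟨ substitute-∙ xh≈hx xg≈gx ⟨
      substitute G w (λ i → h i ∙ x i) g                      ≈⟨ eq ⟩
      -- With `x i` written as `ε ∙ x i`, the same splitting applies to the trivial tuple in place
      -- of `h`.
      substitute G w x g                                      ≈⟨ substitute-cong (λ i → identityˡ (x i)) ⟨
      substitute G w (λ i → ε ∙ x i) g                        ≈⟨ substitute-∙ (λ _ _ → sym commute-ε) xg≈gx ⟩
      substitute G w (λ _ → ε) g ∙ substitute G w x (λ _ → ε) ∎)

  -- With `b` listing the entries of h and g, this is the finite index of K: finitely many
  -- conditions, each pulled back along a coordinate from the centraliser of one `b j`.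
  fc⇒commute-colourable : IsFC G → ∀ {n m} (b : Fin m → Carrier) →
    FinitelyColourable {A = Fin n → Carrier} (λ x y → ∀ i j → Commute (x i ⁻¹ ∙ y i) (b j))
  fc⇒commute-colourable fc b = colourable-⋂ λ i → colourable-⋂ λ j →
    colourable-∘ (λ x → x i) (finiteIndex⇒colourable G (centraliser G (b j)) (fc (b j)))

theorem3p2 : {a ℓ p : Level} (G₁ : Group a ℓ) → IsFC G₁ →
    (n m : ℕ) (G : Subgroup (G₁ ^ᴳ n) p) (w : Word (Fin n ⊎ Fin m))
    (g : Fin m → Group.Carrier G₁) (c : Group.Carrier G₁) →
    let open Group G₁ using (_≈_)
        open Subgroup G using (asGroup)
    in IsLarge asGroup (λ h → substitute G₁ w (proj₁ h) g ≈ c) →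
       (h : Group.Carrier asGroup) → substitute G₁ w (proj₁ h) g ≈ c
theorem3p2 G₁ fc n m G w g c large h =
  -- A single point of the large set identifies the constant value as `c`.
  let x₀ , x₀∈X = large⇒satisfiable 𝔾 large
  in trans (constant h) (trans (sym (constant x₀)) x₀∈X)
  where
  open Group G₁ using (_≈_; ε; sym; trans; ∙-congˡ)
  open GroupProperties G₁ using (\\-leftDividesʳ)
  𝔾 = Subgroup.asGroup G

  constant : ∀ h → substitute G₁ w (proj₁ h) g ≈ substitute G₁ w (λ _ → ε) g
  constant h@(h₁ , _) =
    -- The colouring lives on all tuples over `G₁` and is restricted to `G` along `proj₁`; `h₁ ++ g`
    -- collects everything that `x₁` has to commute with.
    let (x₁ , _) , x′ , x∈X , x′∈X , x′≈hx , z , y , z⁻¹y-commutes , y≈zx =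
          large⇒monochromatic 𝔾 large
            (colourable-∘ proj₁ (fc⇒commute-colourable G₁ fc (h₁ ++ g))) h
        -- Entrywise `z ⁻¹ ∙ y` equals `x₁`, so the commutation passes to `x₁`.
        x-commutes : ∀ i j → Commute G₁ (x₁ i) ((h₁ ++ g) j)
        x-commutes i j = Subgroup.resp (centraliser G₁ ((h₁ ++ g) j))
          (trans (∙-congˡ (y≈zx i)) (\\-leftDividesʳ (proj₁ z i) (x₁ i))) (z⁻¹y-commutes i j)
    in substitute-≈-ε G₁ w g
         (λ i j → subst (Commute G₁ (x₁ i)) (lookup-++ˡ h₁ g j) (x-commutes i (j ↑ˡ m)))
         (λ i j → subst (Commute G₁ (x₁ i)) (lookup-++ʳ h₁ g j) (x-commutes i (n ↑ʳ j)))
         (trans (sym (substitute-cong G₁ w g x′≈hx)) (trans x′∈X (sym x∈X)))
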